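{- Let, for some $k \in \mathbb{N}$, $\mathcal{C}^k = (A^k_1, \ldots, A^k_{k+1})$ be the chain of co-Büchi automata defined in the context, and let $L^k = \mathcal{L}(A^k_1, \ldots, A^k_{k+1})$. Every first chain element of a COCOA encoding $\Sigma^\omega \setminus L^k$ needs at least $2^k$ many states.
   Context: Automata. A co-Büchi automaton with transition-based acceptance is $(Q,\Sigma,\delta,q_0)$ with finite $Q$, input-complete $\delta\subseteq Q\times\Sigma\times Q\times\{1,2\}$, the color of a transition ($1$ = rejecting, $2$ = accepting) depending only on its source state and letter; a run is accepting if the lowest color occurring infinitely often is $2$ (i.e. rejecting transitions are taken only finitely often), and a word is accepted if it has an accepting run. It is history-deterministic if its nondeterminism can be resolved letter by letter by an advice function of the finite prefix read so far, such that for every accepted word the resulting run is accepting. The chain $\mathcal{C}^k$. The alphabet is $\Sigma=\{a_1,\ldots,a_{2k+1}\}\cup\{X_1,\ldots,X_k\}\cup\{Y_1,\ldots,Y_k\}$. $A^k_1$ has a single state with accepting self-loops for $a_1,\ldots,a_{2k+1},Y_1,\ldots,Y_k$ and rejecting self-loops for $X_1,\ldots,X_k$. For $2\le i\le k+1$, $A^k_i$ is deterministic with states $q^k_{i,0}$ (initial), $q^k_{i,1}$, $q^k_{i,2}$ and the following transitions: - from $q^k_{i,0}$: accepting self-loops for $a_1,\ldots,a_{2k-2i+4}$ and all $Y_m$ with $m\ne i-1$; rejecting self-loops for $a_{2k-2i+5},\ldots,a_{2k+1},X_1,\ldots,X_k$; a rejecting transition to $q^k_{i,1}$ for $Y_{i-1}$;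 - from $q^k_{i,1}$: accepting self-loops for $a_1,\ldots,a_{2k-2i+4},Y_1,\ldots,Y_k$; rejecting self-loops for $a_{2k-2i+5},\ldots,a_{2k+1}$ and all $X_m$ with $m\neq i-1$; a rejecting transition to $q^k_{i,2}$ for $X_{i-1}$; - from $q^k_{i,2}$: accepting self-loops for $a_1,\ldots,a_{2k-2i+3},Y_1,\ldots,Y_k$; rejecting self-loops for $a_{2k-2i+4},\ldots,a_{2k+1},X_1,\ldots,X_k$. For a chain of automata, $\mathcal{L}(A_1,\ldots,A_n)$ is the set of words $w$ such that $w\notin \mathcal{L}(A_1)$ or the highest $i$ with $w\in \mathcal{L}(A_i)$ is even. Natural colors. Here $\mathbb{N}$ contains $0$. Fix an $\omega$-regular language $L$ and write $L|_u=\{w'\in\Sigma^\omega\mid uw'\in L\}$. For $w = w_0w_1\ldots \in \Sigma^\omega$, the word $w_0\ldots w_i \tilde w w_{i+1} w_{i+2}\ldots$ results from a residual language invariant injection of $\tilde w\in\Sigma^*$ at position $i$ if $L|_{w_0\ldots w_i} = L|_{w_0\ldots w_i\tilde w}$. A word $w$ is at home in a color of $i \in \mathbb{N}$ if there exists an (infinite) sequence of injection points $J \subset \mathbb{N}$ such that for all words $w'$ that result from injecting residual language invariant words at word positions in $J$ into $w$, either $w'$ is at home in a color strictly smaller than $i$, or both $w,w' \in L$ and $i$ is even, or both $w,w' \notin L$ and $i$ is odd (for $i=0$ only the latter kind of condition can apply). The natural color of $w$ (w.r.t. $L$) is the minimal color in which $w$ is at home. COCOA. A chain of co-Büchi automata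 (COCOA) for (encoding) $L$ is a sequence $(B_1,\ldots,B_n)$ of history-deterministic co-Büchi automata with transition-based acceptance with $\mathcal{L}(B_1)\supset\cdots\supset\mathcal{L}(B_n)$ such that $B_1$ rejects exactly the words of natural color $0$ w.r.t. $L$ and, for each $1\le i\le n$, the words accepted by $B_i$ but rejected by $B_{i+1}$ (if $i<n$) are exactly those of natural color $i$ w.r.t. $L$. -}

module Defs where

open import Data.Bool using (if_then_else_)
open import Data.Fin using (Fin; zero; suc; toℕ; fromℕ; inject₁)
import Data.Fin as Fin
open import Data.List using (List; []; _∷_; _++_; _∷ʳ_; applyUpTo)
open import Data.List.Properties using (applyUpTo-∷ʳ)
open import Data.Nat using (ℕ; zero; suc; _+_; _*_; _∸_; _≤_; _<_; _≤?_)
open import Data.Nat.Divisibility using (_∣_; _∤_)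
open import Data.Product using (∃; ∃₂; ∃-syntax; _×_; _,_; proj₁; proj₂)
open import Data.Sum using (_⊎_)
open import Function using (_∘_; _⇔_)
open import Level using (0ℓ)
open import Relation.Binary.Core using (_Preserves_⟶_)
open import Relation.Binary.PropositionalEquality
  using (_≡_; _≢_; refl; sym; trans; cong; subst)
open import Relation.Nullary using (⌊_⌋)
open import Relation.Unary using (Pred; _∈_; _∉_; _≐_; _⊃_)

private
  variable
    Σ : Set

Word : Set → Set
Word Σ = ℕ → Σ

Language : Set → Set₁
Language Σ = Pred (Word Σ) 0ℓ

infixr 5 _∷ω_ _++ω_

_∷ω_ : Σ → Word Σ → Word Σ
(x ∷ω w) zero    = x
(x ∷ω w) (suc n) = w n

_++ω_ : List Σ → Word Σ → Word Σ
[]      ++ω w = w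
(x ∷ u) ++ω w = x ∷ω (u ++ω w)

------------------------------------------------------------------------
-- Co-Büchi automata

-- rejecting is color 1, accepting is color 2.
data Color : Set where
  rejecting accepting : Color

record CoBuchi (Σ : Set) : Set₁ where
  field
    size     : ℕ
    δ        : Fin size → Σ → Fin size → Color → Set
    q₀       : Fin size
    complete : ∀ q x → ∃₂ λ q′ c → δ q x q′ c
    colored  : ∀ {q x q′ q″ c c′} → δ q x q′ c → δ q x q″ c′ → c ≡ c′

  State : Set
  State = Fin size

module _ (A : CoBuchi Σ) where
  open CoBuchi A

  record Run (w : Word Σ) : Set where
    field
      state : ℕ → State
      color : ℕ → Color
      start : state 0 ≡ q₀
      step  : ∀ i → δ (state i) (w i) (state (suc i)) (color i)

  Accepting : ∀ {w} → Run w → Set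
  Accepting r = ∃[ N ] (∀ i → N ≤ i → Run.color r i ≡ accepting)

  Lang : Language Σ
  Lang w = ∃[ r ] Accepting {w} r

  -- advice u is the state reached after reading the finite word u; the
  -- color of the transition taken is determined by its source and letter.
  record Advice : Set where
    field
      advice : List Σ → State
      start  : advice [] ≡ q₀
      step   : ∀ u x → ∃[ c ] δ (advice u) x (advice (u ∷ʳ x)) c

    run : (w : Word Σ) → Run w
    run w = record
      { state = λ i → advice (applyUpTo w i)
      ; color = λ i → proj₁ (step (applyUpTo w i) (w i))
      ; start = start
      ; step  = λ i → subst (λ u → δ (advice (applyUpTo w i)) (w i) (advice u)
                                     (proj₁ (step (applyUpTo w i) (w i))))
                            (applyUpTo-∷ʳ w i)
                            (proj₂ (step (applyUpTo w i) (w i)))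
      }

  HistoryDeterministic : Set
  HistoryDeterministic =
    ∃[ σ ] (∀ w → w ∈ Lang → Accepting (Advice.run σ w))

deterministic : (n : ℕ) → (Fin n → Σ → Fin n × Color) → Fin n → CoBuchi Σ
deterministic n step q₀ = record
  { size     = n
  ; δ        = λ q x q′ c → step q x ≡ (q′ , c)
  ; q₀       = q₀
  ; complete = λ q x → proj₁ (step q x) , proj₂ (step q x) , refl
  ; colored  = λ e e′ → cong proj₂ (trans (sym e) e′)
  }

-- The language of a chain A₁, …, A₍ₙ₊₁₎, where Aᵢ is stored at index i - 1.
ChainLang : ∀ {n} → (Fin (suc n) → CoBuchi Σ) → Language Σ
ChainLang A w =
  w ∉ Lang (A zero) ⊎
  (∃[ p ] w ∈ Lang (A p)
        × (∀ p′ → w ∈ Lang (A p′) → p′ Fin.≤ p)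
        × 2 ∣ suc (toℕ p))

------------------------------------------------------------------------
-- Natural colors

residual : Language Σ → List Σ → Language Σ
residual L u w = L (u ++ω w)

-- w₀ · v 0 · w₁ · v 1 · w₂ · v 2 · …
inject : Word Σ → (ℕ → List Σ) → Word Σ
inject w v zero = w 0
inject w v (suc n) with v 0
... | []     = inject (w ∘ suc) (v ∘ suc) n
... | x ∷ xs = inject (x ∷ω (w ∘ suc)) (xs ∷ω (v ∘ suc)) n

-- v assigns to each position the word injected there; no injection is the
-- same as injecting [].  It suffices to compare residuals along the original
-- word, since invariant injections do not change the residual of a prefix.
record InvariantInjections
         (L : Language Σ) (w : Word Σ) (J : Pred ℕ 0ℓ) (v : ℕ → List Σ) : Set where
  field
    only-at   : ∀ i → i ∉ J → v i ≡ []
    invariant : ∀ i → residual L (applyUpTo w (suc i))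
                    ≐ residual L (applyUpTo w (suc i) ++ v i)

-- The infinite set J is given by its increasing enumeration j.
data AtHome (L : Language Σ) (i : ℕ) (w : Word Σ) : Set where
  at-home :
    (j : ℕ → ℕ) → j Preserves _<_ ⟶ _<_ →
    (∀ v → InvariantInjections L w (λ m → ∃[ n ] j n ≡ m) v →
       (∃[ i′ ] i′ < i × AtHome L i′ (inject w v))
     ⊎ (w ∈ L × inject w v ∈ L × 2 ∣ i)
     ⊎ (w ∉ L × inject w v ∉ L × 2 ∤ i)) →
    AtHome L i w

NaturalColor : Language Σ → ℕ → Word Σ → Set
NaturalColor L i w = AtHome L i w × (∀ i′ → AtHome L i′ w → i ≤ i′)

-- B₁, …, B₍ₙ₊₁₎ with Bᵢ stored at index i - 1.
record IsCOCOA (L : Language Σ) {n : ℕ} (B : Fin (suc n) → CoBuchi Σ) : Set where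
  field
    history-deterministic : ∀ p → HistoryDeterministic (B p)
    decreasing : ∀ (p : Fin n) → Lang (B (inject₁ p)) ⊃ Lang (B (suc p))
    color-zero : ∀ w → w ∉ Lang (B zero) ⇔ NaturalColor L 0 w
    color-mid  : ∀ (p : Fin n) w →
      (w ∈ Lang (B (inject₁ p)) × w ∉ Lang (B (suc p)))
        ⇔ NaturalColor L (suc (toℕ p)) w
    color-last : ∀ w → w ∈ Lang (B (fromℕ n)) ⇔ NaturalColor L (suc n) w

------------------------------------------------------------------------
-- The chain 𝒞ᵏ

-- The index m of each letter is shifted: a m stands for a₍ₘ₊₁₎, and
-- likewise for X and Y.
data Letter (k : ℕ) : Set where
  a : Fin (suc (2 * k)) → Letter k
  X : Fin k → Letter k
  Y : Fin k → Letter k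

-- The color that makes exactly a₁, …, a_b accepting.
up-to : ∀ {n} → ℕ → Fin n → Color
up-to b m = if ⌊ suc (toℕ m) ≤? b ⌋ then accepting else rejecting

first-step : ∀ k → Fin 1 → Letter k → Fin 1 × Color
first-step k q (a _) = q , accepting
first-step k q (X _) = q , rejecting
first-step k q (Y _) = q , accepting

A-first : ∀ k → CoBuchi (Letter k)
A-first k = deterministic 1 (first-step k) zero

pattern s₀ = zero
pattern s₁ = suc zero
pattern s₂ = suc (suc zero)

-- Given l, these are the transitions of Aᵏᵢ for i = l + 2, so that X l and Y l
-- are X₍ᵢ₋₁₎ and Y₍ᵢ₋₁₎.  As i ≤ k + 1, the subtractions are never truncated.
later-step : ∀ k → Fin k → Fin 3 → Letter k → Fin 3 × Color
later-step k l s₀ (a m) = s₀ , up-to ((2 * k + 4) ∸ 2 * (toℕ l + 2)) m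
later-step k l s₀ (X m) = s₀ , rejecting
later-step k l s₀ (Y m) = if ⌊ m Fin.≟ l ⌋ then (s₁ , rejecting) else (s₀ , accepting)
later-step k l s₁ (a m) = s₁ , up-to ((2 * k + 4) ∸ 2 * (toℕ l + 2)) m
later-step k l s₁ (X m) = (if ⌊ m Fin.≟ l ⌋ then s₂ else s₁) , rejecting
later-step k l s₁ (Y m) = s₁ , accepting
later-step k l s₂ (a m) = s₂ , up-to ((2 * k + 3) ∸ 2 * (toℕ l + 2)) m
later-step k l s₂ (X m) = s₂ , rejecting
later-step k l s₂ (Y m) = s₂ , accepting

A-later : ∀ k → Fin k → CoBuchi (Letter k)
A-later k l = deterministic 3 (later-step k l) s₀

𝒞 : ∀ k → Fin (suc k) → CoBuchi (Letter k)
𝒞 k zero    = A-first k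
𝒞 k (suc l) = A-later k l

Lᵏ : ∀ k → Language (Letter k)
Lᵏ k = ChainLang (𝒞 k)

{-# OPTIONS --safe #-}

-- Reading Y_l moves A_(l+1) from state 0 to state 1, so the words u_s listing the Y_l
-- with l ∈ s realise all state vectors in {0,1}ᵏ.  Suppose l ∉ s, l ∈ t, and let
-- w = X_l Y₁ … Y_k a_(2k+1)^ω.  After u_s, the word w leads A₂, …, A_(k+1) to state 1;
-- from there an injection is invariant only if it contains no X, so the result stays
-- outside Lᵏ and u_s w has natural color 0 with respect to the complement.  After u_t, it
-- leads A_(l+1) to state 2, where X_l is invariant and can be injected infinitely often,
-- so u_t w does not have natural color 0.  Hence the residuals of 𝓛(B₁) by the words u_s
-- are pairwise distinct, and the history-deterministic B₁ is in distinct states after them.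
module Submission where

open import Defs
open import Data.Empty using (⊥)
open import Data.Fin
  using (Fin; zero; suc; toℕ; fromℕ; fromℕ<; inject₁; finToFun; funToFin; combine)
import Data.Fin as Fin
open import Data.Fin.Properties
  using ( pigeonhole; any?; funToFin-finToFin; toℕ-fromℕ; toℕ-fromℕ<; toℕ-inject₁
        ; ≤∧≢⇒<; ≤-antisym; toℕ<n; <⇒≢ )
open import Data.List
  using (List; []; _∷_; _++_; length; map; filter; foldl; applyUpTo; allFin)
open import Data.List.Properties using (foldl-++; ++-identityʳ; ++-assoc)
open import Data.List.Membership.Propositional
  using () renaming (_∈_ to _∈ˡ_; _∉_ to _∉ˡ_)
open import Data.List.Membership.Propositional.Properties
  using (∈-filter⁺; ∈-filter⁻; ∈-allFin)
open import Data.List.Relation.Unary.All as All using (All; []; _∷_)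
open import Data.List.Relation.Unary.Any using (here; there)
open import Data.Nat
  using (ℕ; zero; suc; _+_; _*_; _∸_; _^_; _≤_; _<_; _≤?_; _≟_; _⊔_; z≤n; s≤s; s≤s⁻¹)
open import Data.Nat.Divisibility
  using (_∣_; _∤_; _∣0; ∣-refl; ∣m∣n⇒∣m+n; ∣m+n∣m⇒∣n; ∣1⇒≡1)
open import Data.Nat.Properties
  using ( ≤-refl; ≤-trans; ≤-reflexive; ≤-<-trans; <⇒≱; ≤⇒≯; ≰⇒>; ≮⇒≥
        ; n≤1+n; m≤m+n; m≤m⊔n; m≤n⊔m; m+[n∸m]≡n; m∸n≤m; m∸n+n≡m
        ; m<n+o⇒m∸n<o; m+n≤o⇒m≤o∸n
        ; +-suc; +-comm; +-monoʳ-<; +-monoˡ-<; +-monoʳ-≤; +-monoˡ-≤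
        ; *-suc; *-monoʳ-≤; *-monoʳ-< )
open import Data.Nat.Tactic.RingSolver using (solve-∀)
open import Data.Product using (∃-syntax; _×_; _,_; proj₁; proj₂)
open import Data.Sum using (_⊎_; inj₁; inj₂)
open import Function using (_∘_; const; _⇔_; mk⇔; Equivalence)
open import Relation.Binary.PropositionalEquality
  using (_≡_; _≢_; refl; sym; trans; cong; cong₂; subst; _≗_; module ≡-Reasoning)
open import Relation.Nullary using (¬_; Dec; yes; no; contradiction)
open import Relation.Nullary.Decidable using (_×-dec_; map′)
open import Relation.Unary using (∁; _∈_; _∉_; _≐_)

private
  variable
    Γ : Set

-- Infinite words and finite functions.

++ω-assoc : ∀ u v (w : Word Γ) → (u ++ v) ++ω w ≡ u ++ω (v ++ω w)
++ω-assoc []      v w = refl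
++ω-assoc (x ∷ u) v w = cong (x ∷ω_) (++ω-assoc u v w)

++ω-tail : ∀ u (w : Word Γ) i → (u ++ω w) (length u + i) ≡ w i
++ω-tail []      w i = refl
++ω-tail (x ∷ u) w i = ++ω-tail u w i

funToFin-cong : ∀ {m n} {f g : Fin m → Fin n} → f ≗ g → funToFin f ≡ funToFin g
funToFin-cong {zero}  f≗g = refl
funToFin-cong {suc m} f≗g = cong₂ combine (f≗g zero) (funToFin-cong (f≗g ∘ suc))

finToFun-injective : ∀ {m n} {i j : Fin (m ^ n)} → finToFun {m} {n} i ≗ finToFun j → i ≡ j
finToFun-injective {m} {n} {i} {j} eq =
  trans (sym (funToFin-finToFin {n} {m} i)) (trans (funToFin-cong eq) (funToFin-finToFin {n} {m} j))

-- Runs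

_startingAt_ : (A : CoBuchi Γ) → CoBuchi.State A → CoBuchi Γ
A startingAt q = record A { q₀ = q }

module _ (A : CoBuchi Γ) where
  open CoBuchi A

  Lang-∷ : ∀ {q x q′ c w} → δ q x q′ c →
           w ∈ Lang (A startingAt q′) → (x ∷ω w) ∈ Lang (A startingAt q)
  Lang-∷ {q} {x} {q′} {c} {w} e (r , N , acc) = r′ , suc N , acc′
    where
    open Run r
    r′ : Run (A startingAt q) (x ∷ω w)
    r′ = record
      { state = q ∷ω state
      ; color = c ∷ω color
      ; start = refl
      ; step  = λ { zero    → subst (λ s → δ q x s c) (sym start) e
                  ; (suc i) → step i }
      }
    acc′ : ∀ i → suc N ≤ i → Run.color r′ i ≡ accepting
    acc′ (suc i) (s≤s N≤i) = acc i N≤i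

  drop-accepting : ∀ {q w} (r : Run (A startingAt q) w) → Accepting _ r →
         (w ∘ suc) ∈ Lang (A startingAt Run.state r 1)
  drop-accepting r (N , acc) =
    record { state = state ∘ suc ; color = color ∘ suc ; start = refl ; step = step ∘ suc } ,
    N , λ i N≤i → acc (suc i) (≤-trans N≤i (n≤1+n i))
    where open Run r

  drop-accepting* : ∀ u {q w} (r : Run (A startingAt q) (u ++ω w)) → Accepting _ r →
         w ∈ Lang (A startingAt Run.state r (length u))
  drop-accepting* []      r acc =
    record { state = state ; color = color ; start = refl ; step = step } , acc
    where open Run r
  drop-accepting* (x ∷ u) r acc =
    let r′ , acc′ = drop-accepting r acc in drop-accepting* u r′ acc′

applyUpTo-++ω : ∀ u (w : Word Γ) → applyUpTo (u ++ω w) (length u) ≡ u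
applyUpTo-++ω []      w = refl
applyUpTo-++ω (x ∷ u) w = cong (x ∷_) (applyUpTo-++ω u w)

module _ (A : CoBuchi Γ) (σ : Advice A) where
  open CoBuchi A
  open Advice σ

  Lang-advice-++ : ∀ u v {w} → w ∈ Lang (A startingAt advice (u ++ v)) →
                   (v ++ω w) ∈ Lang (A startingAt advice u)
  Lang-advice-++ u []      w∈ = subst (λ u → _ ∈ Lang (A startingAt advice u)) (++-identityʳ u) w∈
  Lang-advice-++ u (x ∷ v) w∈ =
    Lang-∷ A (proj₂ (step u x))
      (Lang-advice-++ (u ++ x ∷ []) v
        (subst (λ u → _ ∈ Lang (A startingAt advice u)) (sym (++-assoc u (x ∷ []) v)) w∈))

  -- History determinism makes the advice run on `u ++ω w` accepting, and its tail after `u` starts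
  -- in `advice u`. Prefixing this tail with the advice path along `v` gives an accepting run on
  -- `v ++ω w`.
  same-advice⇒same-residual :
    (∀ w → w ∈ Lang A → Accepting A (Advice.run σ w)) →
    ∀ u v w → advice u ≡ advice v → (u ++ω w) ∈ Lang A → (v ++ω w) ∈ Lang A
  same-advice⇒same-residual hd u v w eq uw∈ =
    subst (λ q → (v ++ω w) ∈ Lang (A startingAt q)) start
      (Lang-advice-++ [] v
        (subst (λ q → w ∈ Lang (A startingAt q)) (trans (cong advice (applyUpTo-++ω u w)) eq)
          (drop-accepting* A u (Advice.run σ (u ++ω w)) (hd _ uw∈))))

-- Deterministic automata

module _ {n : ℕ} (step : Fin n → Γ → Fin n × Color) where

  target : Fin n → Γ → Fin n
  target q x = proj₁ (step q x)

  target* : Fin n → List Γ → Fin n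
  target* = foldl target

  Lang-++⁺ : ∀ {q} u {w} → w ∈ Lang (deterministic n step (target* q u)) →
            (u ++ω w) ∈ Lang (deterministic n step q)
  Lang-++⁺ []      w∈ = w∈
  Lang-++⁺ {q} (x ∷ u) w∈ = Lang-∷ (deterministic n step q) refl (Lang-++⁺ u w∈)

  Lang-++⁻ : ∀ {q} u {w} → (u ++ω w) ∈ Lang (deterministic n step q) →
            w ∈ Lang (deterministic n step (target* q u))
  Lang-++⁻ []      w∈ = w∈
  Lang-++⁻ {q} (x ∷ u) {w} (r , acc) =
    Lang-++⁻ u (subst (λ q′ → (u ++ω w) ∈ Lang (deterministic n step q′)) state₁≡
               (drop-accepting (deterministic n step q) r acc))
    where
    state₁≡ : Run.state r 1 ≡ target q x
    state₁≡ = trans (cong proj₁ (sym (Run.step r 0))) (cong (λ q → target q x) (Run.start r))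

  Lang-same-state : ∀ {q} u v {w} → target* q u ≡ target* q v →
            (u ++ω w) ∈ Lang (deterministic n step q) → (v ++ω w) ∈ Lang (deterministic n step q)
  Lang-same-state u v {w} eq uw∈ =
    Lang-++⁺ v (subst (λ q → w ∈ Lang (deterministic n step q)) eq (Lang-++⁻ u uw∈))

  often-rejecting : ∀ {q w} →
    (∀ n → ∃[ m ] n ≤ m × (∀ q → proj₂ (step q (w m)) ≡ rejecting)) →
    w ∉ Lang (deterministic n step q)
  often-rejecting often (r , N , acc) with m , N≤m , rej ← often N =
    contradiction (trans (sym (rej _)) (trans (cong proj₂ (Run.step r m)) (acc m N≤m))) λ ()

  accepting-loop : ∀ {q x} → step q x ≡ (q , accepting) → const x ∈ Lang (deterministic n step q)
  accepting-loop {q} e =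
    record { state = const q ; color = const accepting ; start = refl ; step = const e } ,
    0 , λ _ _ → refl

  -- In contrast to `often-rejecting`, the letter is rejecting only at `q`, so the run has to be
  -- followed: `stays` and `step≡` show by mutual induction that it never leaves `q`.
  rejecting-loop : ∀ {q x} → step q x ≡ (q , rejecting) → const x ∉ Lang (deterministic n step q)
  rejecting-loop {q} {x} e (r , N , acc) =
    contradiction (trans (cong proj₂ (step≡ N)) (acc N ≤-refl)) λ ()
    where
    stays : ∀ i → Run.state r i ≡ q
    step≡ : ∀ i → (q , rejecting) ≡ (Run.state r (suc i) , Run.color r i)
    stays zero    = Run.start r
    stays (suc i) = sym (cong proj₁ (step≡ i))
    step≡ i = trans (sym e) (trans (cong (λ q → step q x) (sym (stays i))) (Run.step r i))

  target*-const : ∀ {q x} → target q x ≡ q → ∀ i → target* q (applyUpTo (const x) i) ≡ q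
  target*-const         e zero    = refl
  target*-const {q} {x} e (suc i) rewrite e = target*-const e i

  target*-++-const : ∀ {q x} u → target (target* q u) x ≡ target* q u →
    ∀ i → target* q (applyUpTo (u ++ω const x) (length u + i)) ≡ target* q u
  target*-++-const []      e i = target*-const e i
  target*-++-const (y ∷ u) e i = target*-++-const u e i

-- Injections

-- Injections only delay the letters of `w`, so a letter that recurs in `w` also recurs in the
-- result.
inject-⊇-word : ∀ i (w : Word Γ) v → ∃[ m ] i ≤ m × inject w v m ≡ w i
inject-⊇-word zero w v = 0 , z≤n , refl
inject-⊇-word {Γ} (suc i) w v = go (v 0) w v refl
  where
  -- `inject` consumes an injected word by making its head the new current letter, which changes `w`
  -- and `v` at position 0 only. The recursion therefore runs over `xs` with `w` and `v`
  -- generalized, while `w (suc i)` stays fixed.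
  go : ∀ xs (w : Word Γ) v → v 0 ≡ xs → ∃[ m ] suc i ≤ m × inject w v m ≡ w (suc i)
  go [] w v eq with m , i≤m , e ← inject-⊇-word i (w ∘ suc) (v ∘ suc) =
    suc m , s≤s i≤m , e′
    where
    e′ : inject w v (suc m) ≡ w (suc i)
    e′ rewrite eq = e
  go (x ∷ xs) w v eq with m , i<m , e ← go xs (x ∷ω (w ∘ suc)) (xs ∷ω (v ∘ suc)) refl =
    suc m , ≤-trans i<m (n≤1+n m) , e′
    where
    e′ : inject w v (suc m) ≡ w (suc i)
    e′ rewrite eq = e

inject-⊇-injected : ∀ i (w : Word Γ) v {x} → x ∈ˡ v i → ∃[ m ] i ≤ m × inject w v m ≡ x
inject-⊇-injected zero w v x∈ with v 0 in eq
... | y ∷ ys = go x∈ w v eq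
  where
  go : ∀ {x y ys} → x ∈ˡ y ∷ ys → ∀ w v → v 0 ≡ y ∷ ys → ∃[ m ] 0 ≤ m × inject w v m ≡ x
  go {x} {y} (here refl) w v eq = 1 , z≤n , e
    where
    e : inject w v 1 ≡ x
    e rewrite eq = refl
  go {x} {y} {ys@(_ ∷ _)} (there x∈) w v eq
    with m , _ , e ← go x∈ (y ∷ω (w ∘ suc)) (ys ∷ω (v ∘ suc)) refl = suc m , z≤n , e′
    where
    e′ : inject w v (suc m) ≡ x
    e′ rewrite eq = e
inject-⊇-injected {Γ} (suc i) w v {x} x∈ = go (v 0) w v refl x∈
  where
  go : ∀ xs (w : Word Γ) v → v 0 ≡ xs → x ∈ˡ v (suc i) → ∃[ m ] suc i ≤ m × inject w v m ≡ x
  go [] w v eq x∈ with m , i≤m , e ← inject-⊇-injected i (w ∘ suc) (v ∘ suc) x∈ =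
    suc m , s≤s i≤m , e′
    where
    e′ : inject w v (suc m) ≡ x
    e′ rewrite eq = e
  go (y ∷ ys) w v eq x∈ with m , i<m , e ← go ys (y ∷ω (w ∘ suc)) (ys ∷ω (v ∘ suc)) refl x∈ =
    suc m , ≤-trans i<m (n≤1+n m) , e′
    where
    e′ : inject w v (suc m) ≡ x
    e′ rewrite eq = e

-- The first `N` letters are exempt from `P`. As nothing is injected at their positions, they stay
-- where they are.
inject-all : ∀ {P : Γ → Set} N (w : Word Γ) v →
  (∀ i → i < N → v i ≡ []) → (∀ i → N ≤ i → P (w i)) → (∀ i → All P (v i)) →
  ∀ n → N ≤ n → P (inject w v n)
inject-all zero w v none pw pv zero    _ = pw 0 z≤n
inject-all zero w v none pw pv (suc n) _ with v 0 | pv 0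
... | []     | _        =
  inject-all 0 (w ∘ suc) (v ∘ suc) (λ _ ()) (λ i _ → pw (suc i) z≤n) (pv ∘ suc) n z≤n
... | x ∷ xs | px ∷ pxs =
  inject-all 0 (x ∷ω (w ∘ suc)) (xs ∷ω (v ∘ suc)) (λ _ ())
    (λ { zero _ → px ; (suc i) _ → pw (suc i) z≤n })
    (λ { zero → pxs ; (suc i) → pv (suc i) }) n z≤n
inject-all (suc N) w v none pw pv (suc n) (s≤s N≤n) rewrite none 0 (s≤s z≤n) =
  inject-all N (w ∘ suc) (v ∘ suc)
    (λ i i<N → none (suc i) (s≤s i<N)) (λ i N≤i → pw (suc i) (s≤s N≤i)) (pv ∘ suc) n N≤n

-- Highest accepting chain elements

Highest : ∀ {n} → (Fin (suc n) → CoBuchi Γ) → Word Γ → Fin (suc n) → Set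
Highest A w p = w ∈ Lang (A p) × (∀ p′ → w ∈ Lang (A p′) → p′ Fin.≤ p)

-- Two maximal accepting indices coincide by antisymmetry, so the parity of any one of them decides
-- membership.
ChainLang-highest : ∀ {n} {A : Fin (suc n) → CoBuchi Γ} {w p} →
  w ∈ Lang (A zero) → Highest A w p → ChainLang A w ⇔ 2 ∣ suc (toℕ p)
ChainLang-highest {A = A} {w} {p} w∈A₀ (w∈Aₚ , max) = mk⇔ to λ even → inj₂ (p , w∈Aₚ , max , even)
  where
  to : ChainLang A w → 2 ∣ suc (toℕ p)
  to (inj₁ w∉A₀) = contradiction w∈A₀ w∉A₀
  to (inj₂ (p′ , w∈Aₚ′ , max′ , even)) =
    subst (λ p → 2 ∣ suc (toℕ p)) (≤-antisym (max p′ w∈Aₚ′) (max′ p w∈Aₚ)) even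

ChainLang-resp : ∀ {n} {A : Fin (suc n) → CoBuchi Γ} {w w′} →
  (∀ p → w ∈ Lang (A p) ⇔ w′ ∈ Lang (A p)) → ChainLang A w → ChainLang A w′
ChainLang-resp same (inj₁ w∉A₀) = inj₁ (w∉A₀ ∘ Equivalence.from (same zero))
ChainLang-resp same (inj₂ (p , w∈Aₚ , max , even)) =
  inj₂ (p , Equivalence.to (same p) w∈Aₚ , (λ p′ → max p′ ∘ Equivalence.from (same p′)) , even)

2∣n⊎2∣1+n : ∀ n → 2 ∣ n ⊎ 2 ∣ suc n
2∣n⊎2∣1+n zero = inj₁ (2 ∣0)
2∣n⊎2∣1+n (suc n) with 2∣n⊎2∣1+n n
... | inj₁ 2∣n   = inj₂ (∣m∣n⇒∣m+n ∣-refl 2∣n)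
... | inj₂ 2∣1+n = inj₁ 2∣1+n

2∤1 : 2 ∤ 1
2∤1 2∣1 with () ← ∣1⇒≡1 2∣1

2∣n⇒2∤1+n : ∀ {n} → 2 ∣ n → 2 ∤ suc n
2∣n⇒2∤1+n {n} 2∣n 2∣1+n =
  2∤1 (∣m+n∣m⇒∣n (subst (2 ∣_) (+-comm 1 n) 2∣1+n) 2∣n)

-- The automata of 𝒞ᵏ

up-to-accepting : ∀ {n} {m : Fin n} o d → suc (toℕ m) + d ≤ o → up-to (o ∸ d) m ≡ accepting
up-to-accepting {m = m} o d le with suc (toℕ m) ≤? o ∸ d
... | yes _ = refl
... | no ≰  = contradiction (m+n≤o⇒m≤o∸n (suc (toℕ m)) le) ≰

up-to-rejecting : ∀ {n} {m : Fin n} o d → o < suc (toℕ m) + d → up-to (o ∸ d) m ≡ rejecting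
up-to-rejecting {m = m} o d lt with suc (toℕ m) ≤? o ∸ d
... | yes le = contradiction (m<n+o⇒m∸n<o o d (subst (o <_) (+-comm (suc (toℕ m)) d) lt)) (≤⇒≯ le)
... | no _  = refl

module _ (k : ℕ) where

  state : Fin k → List (Letter k) → Fin 3
  state l = target* (later-step k l) s₀

  module _ (l : Fin k) where

    δ̂ : Fin 3 → List (Letter k) → Fin 3
    δ̂ = target* (later-step k l)

    later-a : ∀ q m → target (later-step k l) q (a m) ≡ q
    later-a s₀ m = refl
    later-a s₁ m = refl
    later-a s₂ m = refl

    later-s₂ : ∀ x → target (later-step k l) s₂ x ≡ s₂
    later-s₂ (a m) = refl
    later-s₂ (X m) = refl
    later-s₂ (Y m) = refl

    later-X-≢ : ∀ q {m} → m ≢ l → target (later-step k l) q (X m) ≡ q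
    later-X-≢ s₀     m≢l = refl
    later-X-≢ s₁ {m} m≢l with m Fin.≟ l
    ... | yes m≡l = contradiction m≡l m≢l
    ... | no _    = refl
    later-X-≢ s₂     m≢l = refl

    later-X-≡ : target (later-step k l) s₁ (X l) ≡ s₂
    later-X-≡ with l Fin.≟ l
    ... | yes _ = refl
    ... | no ≢  = contradiction refl ≢

    δ̂-s₂ : ∀ u → δ̂ s₂ u ≡ s₂
    δ̂-s₂ []      = refl
    δ̂-s₂ (x ∷ u) rewrite later-s₂ x = δ̂-s₂ u

    -- The letters before the first `X l` are loops at `s₁`, that letter leads to `s₂`, and `s₂` is
    -- never left.
    δ̂-X∈ : ∀ u → X l ∈ˡ u → δ̂ s₁ u ≡ s₂
    δ̂-X∈ (_ ∷ u) (here refl) rewrite later-X-≡ = δ̂-s₂ u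
    δ̂-X∈ (a _ ∷ u) (there X∈) = δ̂-X∈ u X∈
    δ̂-X∈ (Y _ ∷ u) (there X∈) = δ̂-X∈ u X∈
    δ̂-X∈ (X m ∷ u) (there X∈) with m Fin.≟ l
    ... | yes _ = δ̂-s₂ u
    ... | no _  = δ̂-X∈ u X∈

    δ̂-Ys-s₁ : ∀ ms → δ̂ s₁ (map Y ms) ≡ s₁
    δ̂-Ys-s₁ []       = refl
    δ̂-Ys-s₁ (_ ∷ ms) = δ̂-Ys-s₁ ms

    δ̂-Ys-∈ : ∀ ms → l ∈ˡ ms → δ̂ s₀ (map Y ms) ≡ s₁
    δ̂-Ys-∈ (m ∷ ms) l∈ with m Fin.≟ l | l∈
    ... | yes _ | _         = δ̂-Ys-s₁ ms
    ... | no ≢  | here refl = contradiction refl ≢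
    ... | no _  | there l∈′ = δ̂-Ys-∈ ms l∈′

    δ̂-Ys-∉ : ∀ ms → l ∉ˡ ms → δ̂ s₀ (map Y ms) ≡ s₀
    δ̂-Ys-∉ []       _  = refl
    δ̂-Ys-∉ (m ∷ ms) l∉ with m Fin.≟ l
    ... | yes refl = contradiction (here refl) l∉
    ... | no _     = δ̂-Ys-∉ ms (l∉ ∘ there)

  -- probe l is the letter a_(2k-2l) of the paper.  A-later k i accepts it in every state
  -- for i < l and rejects it for i > l; for i = l, it is accepted in s₁ and rejected in s₂.
  module _ (l : Fin k) where

    probe : Fin (suc (2 * k))
    probe = fromℕ< {2 * k ∸ suc (2 * toℕ l)} (s≤s (m∸n≤m (2 * k) (suc (2 * toℕ l))))

    2l<2k : suc (suc (2 * toℕ l)) ≤ 2 * k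
    2l<2k = subst (_≤ 2 * k) (*-suc 2 (toℕ l)) (*-monoʳ-≤ 2 (toℕ<n l))

    suc-probe : suc (toℕ probe) + 2 * toℕ l ≡ 2 * k
    suc-probe = begin
      suc (toℕ probe) + 2 * toℕ l  ≡⟨ sym (+-suc (toℕ probe) (2 * toℕ l)) ⟩
      toℕ probe + suc (2 * toℕ l)  ≡⟨ cong (_+ suc (2 * toℕ l)) (toℕ-fromℕ< _) ⟩
      2 * k ∸ suc (2 * toℕ l) + suc (2 * toℕ l)
        ≡⟨ m∸n+n≡m (≤-trans (n≤1+n _) 2l<2k) ⟩
      2 * k ∎
      where open ≡-Reasoning

    -- The one-based index of `probe` is exactly the bound in force at `s₁`, hence one more than the
    -- bound at `s₂`. The equation is additive to avoid truncated subtraction.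
    shift : suc (toℕ probe) + 2 * (toℕ l + 2) ≡ 2 * k + 4
    shift = trans (lemma (suc (toℕ probe)) (toℕ l)) (cong (_+ 4) suc-probe)
      where
      lemma : ∀ p l → p + 2 * (l + 2) ≡ (p + 2 * l) + 4
      lemma = solve-∀

    probe-s₁ : later-step k l s₁ (a probe) ≡ (s₁ , accepting)
    probe-s₁ = cong (s₁ ,_) (up-to-accepting (2 * k + 4) (2 * (toℕ l + 2)) (≤-reflexive shift))

    probe-s₂ : later-step k l s₂ (a probe) ≡ (s₂ , rejecting)
    probe-s₂ = cong (s₂ ,_) (up-to-rejecting (2 * k + 3) (2 * (toℕ l + 2))
      (≤-trans (≤-reflexive (sym (+-suc (2 * k) 3))) (≤-reflexive (sym shift))))

    probe-below : ∀ {i} → i Fin.< l → ∀ q → later-step k i q (a probe) ≡ (q , accepting)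
    probe-below {i} i<l q = by-state q
      where
      -- Passing from `l` to a smaller `i` raises the bounds by at least two, which outweighs the
      -- loss of one at `s₂`. The constants 4 and 3 of the transition table are then both covered by
      -- `2 ≤ c`.
      le : suc (toℕ probe) + 2 * (toℕ i + 2) ≤ 2 * k + 2
      le = s≤s⁻¹ (s≤s⁻¹ (≤-trans (≤-reflexive (lemma (suc (toℕ probe)) (toℕ i)))
             (≤-trans (+-monoʳ-≤ (suc (toℕ probe)) (*-monoʳ-≤ 2 (+-monoˡ-≤ 2 i<l)))
               (≤-reflexive (trans shift (lemma′ (2 * k)))))))
        where
        lemma : ∀ p i → 2 + (p + 2 * (i + 2)) ≡ p + 2 * (suc i + 2)
        lemma = solve-∀
        lemma′ : ∀ m → m + 4 ≡ 2 + (m + 2)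
        lemma′ = solve-∀
      bound : ∀ c → 2 ≤ c → up-to ((2 * k + c) ∸ 2 * (toℕ i + 2)) probe ≡ accepting
      bound c 2≤c = up-to-accepting (2 * k + c) (2 * (toℕ i + 2))
                      (≤-trans le (+-monoʳ-≤ (2 * k) 2≤c))
      by-state : ∀ q → later-step k i q (a probe) ≡ (q , accepting)
      by-state s₀ = cong (s₀ ,_) (bound 4 (s≤s (s≤s z≤n)))
      by-state s₁ = cong (s₁ ,_) (bound 4 (s≤s (s≤s z≤n)))
      by-state s₂ = cong (s₂ ,_) (bound 3 (s≤s (s≤s z≤n)))

  always-rejecting : ∀ l m → 2 * k + 4 < suc (toℕ m) + 2 * (toℕ l + 2) →
    ∀ q → proj₂ (later-step k l q (a m)) ≡ rejecting
  always-rejecting l m lt s₀ = up-to-rejecting (2 * k + 4) (2 * (toℕ l + 2)) lt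
  always-rejecting l m lt s₁ = up-to-rejecting (2 * k + 4) (2 * (toℕ l + 2)) lt
  always-rejecting l m lt s₂ = up-to-rejecting (2 * k + 3) (2 * (toℕ l + 2))
    (≤-<-trans (+-monoʳ-≤ (2 * k) (n≤1+n 3)) lt)

  probe-above : ∀ l {i} → l Fin.< i → ∀ q → proj₂ (later-step k i q (a (probe l))) ≡ rejecting
  probe-above l {i} l<i = always-rejecting i (probe l)
    (subst (_< suc (toℕ (probe l)) + 2 * (toℕ i + 2)) (shift l)
      (+-monoʳ-< (suc (toℕ (probe l)))
        (*-monoʳ-< 2 (+-monoˡ-< 2 l<i))))

  top : Fin (suc (2 * k))
  top = fromℕ (2 * k)

  -- `top` has one-based index `2 * k + 1`, whereas the bounds in the transition tables never exceed
  -- `2 * k`.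
  top-rejecting : ∀ l q → proj₂ (later-step k l q (a top)) ≡ rejecting
  top-rejecting l = always-rejecting l top
    (subst (λ t → 2 * k + 4 < suc t + 2 * (toℕ l + 2)) (sym (toℕ-fromℕ (2 * k)))
      (subst (2 * k + 4 <_) (lemma (2 * k) (toℕ l)) (s≤s (m≤m+n _ (2 * toℕ l)))))
    where
    lemma : ∀ m l → suc ((m + 4) + 2 * l) ≡ suc m + 2 * (l + 2)
    lemma = solve-∀

  -- Words with finitely or infinitely many `X`.

  data NotX : Letter k → Set where
    is-a : ∀ m → NotX (a m)
    is-Y : ∀ m → NotX (Y m)

  all-NotX : ∀ u → (∀ m → X m ∉ˡ u) → All NotX u
  all-NotX u X∉ = All.tabulate λ
    { {a m} _ → is-a m ; {Y m} _ → is-Y m ; {X m} X∈ → contradiction X∈ (X∉ m) }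

  first-accepts : ∀ N w → (∀ n → N ≤ n → NotX (w n)) → w ∈ Lang (A-first k)
  first-accepts N w notX = r , N , λ i N≤i → color≡ (w i) (notX i N≤i)
    where
    r : Run (A-first k) w
    r = record
      { state = const zero
      ; color = λ i → proj₂ (first-step k zero (w i))
      ; start = refl
      ; step  = λ i → step≡ (w i)
      }
      where
      step≡ : ∀ x → first-step k zero x ≡ (zero , proj₂ (first-step k zero x))
      step≡ (a _) = refl
      step≡ (X _) = refl
      step≡ (Y _) = refl
    color≡ : ∀ x → NotX x → proj₂ (first-step k zero x) ≡ accepting
    color≡ _ (is-a _) = refl
    color≡ _ (is-Y _) = refl

  -- `A-first` accepts, and `top` makes every later automaton reject, so the highest accepting
  -- position is 1, which is odd.
  finitely-X∧often-top⇒∉ : ∀ N w → (∀ n → N ≤ n → NotX (w n)) →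
    (∀ n → ∃[ m ] n ≤ m × w m ≡ a top) → w ∉ Lᵏ k
  finitely-X∧often-top⇒∉ N w notX often (inj₁ w∉A₁) = w∉A₁ (first-accepts N w notX)
  finitely-X∧often-top⇒∉ N w notX often (inj₂ (zero , _ , _ , even)) = 2∤1 even
  finitely-X∧often-top⇒∉ N w notX often (inj₂ (suc l , w∈ , _)) =
    often-rejecting (later-step k l) rej w∈
    where
    rej : ∀ n → ∃[ m ] n ≤ m × (∀ q → proj₂ (later-step k l q (w m)) ≡ rejecting)
    rej n with m , n≤m , wm≡ ← often n =
      m , n≤m , λ q → trans (cong (proj₂ ∘ later-step k l q) wm≡) (top-rejecting l q)

  often-X⇒∈ : ∀ w → (∀ n → ∃[ m ] ∃[ l ] n ≤ m × w m ≡ X l) → w ∈ Lᵏ k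
  often-X⇒∈ w often = inj₁ (often-rejecting (first-step k) rej)
    where
    rej : ∀ n → ∃[ m ] n ≤ m × (∀ q → proj₂ (first-step k q (w m)) ≡ rejecting)
    rej n with m , l , n≤m , wm≡ ← often n = m , n≤m , λ q → cong (proj₂ ∘ first-step k q) wm≡

  -- Probe words and the parity of the highest accepting automaton.

  probe∈first : ∀ l u → (u ++ω const (a (probe l))) ∈ Lang (A-first k)
  probe∈first l u = Lang-++⁺ (first-step k) u (accepting-loop (first-step k) refl)

  highest-probe : ∀ l p u → u ++ω const (a (probe l)) ∈ Lang (𝒞 k p) →
    (∀ i → u ++ω const (a (probe l)) ∈ Lang (A-later k i) → suc (toℕ i) ≤ toℕ p) →
    (u ++ω const (a (probe l))) ∈ Lᵏ k ⇔ 2 ∣ suc (toℕ p)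
  highest-probe l p u w∈ max =
    ChainLang-highest {A = 𝒞 k} (probe∈first l u) (w∈ , λ { zero _ → z≤n ; (suc i) → max i })

  probe-rejected-above : ∀ l {i} u → l Fin.< i → (u ++ω const (a (probe l))) ∉ Lang (A-later k i)
  probe-rejected-above l {i} u l<i w∈ =
    often-rejecting (later-step k i) (λ n → n , ≤-refl , probe-above l l<i)
      (Lang-++⁻ (later-step k i) u w∈)

  -- `A-later k l` accepts the probe at `s₁` and everything above it rejects, so the highest
  -- accepting position is `toℕ l + 2`, whatever the states of the other automata.
  probe-after-s₁ : ∀ l u → state l u ≡ s₁ →
    (u ++ω const (a (probe l))) ∈ Lᵏ k ⇔ 2 ∣ suc (suc (toℕ l))
  probe-after-s₁ l u eq = highest-probe l (suc l) u
    (Lang-++⁺ (later-step k l) u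
      (subst (λ q → const _ ∈ Lang (deterministic 3 (later-step k l) q)) (sym eq)
        (accepting-loop (later-step k l) (probe-s₁ l))))
    λ i w∈ → s≤s (≮⇒≥ λ l<i → probe-rejected-above l u l<i w∈)

  -- Now `A-later k l` rejects as well, and its predecessor in the chain is the highest accepting
  -- automaton. Compared with `probe-after-s₁`, the parity flips.
  probe-after-s₂ : ∀ l u → state l u ≡ s₂ →
    (u ++ω const (a (probe l))) ∈ Lᵏ k ⇔ 2 ∣ suc (toℕ l)
  probe-after-s₂ l u eq = subst (λ n → w ∈ Lᵏ k ⇔ 2 ∣ suc n) (toℕ-inject₁ l)
    (highest-probe l (inject₁ l) u (lower (inject₁ l) (toℕ-inject₁ l))
      λ i w∈ → subst (suc (toℕ i) ≤_) (sym (toℕ-inject₁ l)) (≰⇒> λ l≤i → above i l≤i w∈))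
    where
    w = u ++ω const (a (probe l))
    above : ∀ i → l Fin.≤ i → w ∉ Lang (A-later k i)
    above i l≤i with l Fin.≟ i
    ... | no l≢i   = probe-rejected-above l u (≤∧≢⇒< l≤i l≢i)
    ... | yes refl = λ w∈ → rejecting-loop (later-step k l) (probe-s₂ l)
            (subst (λ q → const _ ∈ Lang (deterministic 3 (later-step k l) q)) eq
              (Lang-++⁻ (later-step k l) u w∈))
    below : ∀ i → i Fin.< l → w ∈ Lang (A-later k i)
    below i i<l = Lang-++⁺ (later-step k i) u (accepting-loop (later-step k i) (probe-below l i<l _))
    -- The predecessor is `A-first` if `l` is zero and otherwise a later automaton below `l`;
    -- generalizing `inject₁ l` to `p` allows this case split.
    lower : ∀ p → toℕ p ≡ toℕ l → w ∈ Lang (𝒞 k p)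
    lower zero    _  = probe∈first l u
    lower (suc i) eq = below i (≤-reflexive eq)

  -- Invariant and non-invariant injections.

  state-∷ʳ-X : ∀ l u → state l u ≡ s₂ → ∀ i → state i u ≡ state i (u ++ X l ∷ [])
  state-∷ʳ-X l u eq i = sym (trans (foldl-++ (target (later-step k i)) s₀ u (X l ∷ [])) fixed)
    where
    fixed : target (later-step k i) (state i u) (X l) ≡ state i u
    -- `X l` can move only component `l`, which is already in the absorbing state `s₂`.
    fixed with l Fin.≟ i
    ... | no l≢i   = later-X-≢ i (state i u) l≢i
    ... | yes refl rewrite eq = refl

  Lᵏ-same-states : ∀ u v {w} → (∀ i → state i u ≡ state i v) →
    (u ++ω w) ∈ Lᵏ k → (v ++ω w) ∈ Lᵏ k
  Lᵏ-same-states u v eq = ChainLang-resp {A = 𝒞 k} λ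
    { zero    → mk⇔ (Lang-same-state (first-step k) u v (unique _ _))
                    (Lang-same-state (first-step k) v u (unique _ _))
    ; (suc i) → mk⇔ (Lang-same-state (later-step k i) u v (eq i))
                    (Lang-same-state (later-step k i) v u (sym (eq i))) }
    where
    unique : (p q : Fin 1) → p ≡ q
    unique zero zero = refl

  -- Moving component `l` from `s₁` to `s₂` flips the membership of the probe word. Other
  -- occurrences of `X` in `v` are harmless, since that membership depends on component `l` alone.
  X-not-invariant : ∀ l u v → state l u ≡ s₁ → X l ∈ˡ v →
    ¬ (residual (∁ (Lᵏ k)) u ≐ residual (∁ (Lᵏ k)) (u ++ v))
  X-not-invariant l u v u-s₁ X∈v (⊆ , ⊇) = contra (2∣n⊎2∣1+n (suc (toℕ l)))
    where
    before = probe-after-s₁ l u u-s₁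
    after  = probe-after-s₂ l (u ++ v)
      (trans (foldl-++ (target (later-step k l)) s₀ u v)
        (trans (cong (λ q → δ̂ l q v) u-s₁) (δ̂-X∈ l v X∈v)))
    -- The parity of `toℕ l` decides which of the two inclusions fails.
    contra : 2 ∣ suc (toℕ l) ⊎ 2 ∣ suc (suc (toℕ l)) → ⊥
    contra (inj₁ even) = ⊆ (2∣n⇒2∤1+n even ∘ Equivalence.to before) (Equivalence.from after even)
    contra (inj₂ even) =
      ⊇ (λ w∈ → 2∣n⇒2∤1+n (Equivalence.to after w∈) even) (Equivalence.from before even)

  -- Natural color 0.

  state-prefix : ∀ l u i →
    state l (applyUpTo (u ++ω const (a top)) (suc (length u + i))) ≡ state l u
  state-prefix l u i = subst (λ n → state l (applyUpTo (u ++ω const (a top)) n) ≡ state l u)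
    (+-suc (length u) i)
    (target*-++-const (later-step k l) u (later-a l (state l u) top) (suc i))

  natural-0 : ∀ u → (∀ l → state l u ≡ s₁) → NaturalColor (∁ (Lᵏ k)) 0 (u ++ω const (a top))
  natural-0 u all-s₁ =
    -- The injection points are all positions from `N` on. An injection at `i` comes after letter
    -- `i`, so `u` has been read by then, and the loops on `top` keep every component in `s₁`.
    at-home (N +_) (+-monoʳ-< N) (λ v inv → inj₂ (inj₁ (w∉ , injected∉ v inv , 2 ∣0))) , λ _ _ → z≤n
    where
    N = length u
    w = u ++ω const (a top)

    tail : ∀ i → N ≤ i → w i ≡ a top
    tail i N≤i = trans (cong w (sym (m+[n∸m]≡n N≤i))) (++ω-tail u (const (a top)) (i ∸ N))

    tail-NotX : ∀ i → N ≤ i → NotX (w i)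
    tail-NotX i N≤i = subst NotX (sym (tail i N≤i)) (is-a top)

    w∉ : w ∉ Lᵏ k
    w∉ = finitely-X∧often-top⇒∉ N w tail-NotX λ n → N ⊔ n , m≤n⊔m N n , tail _ (m≤m⊔n N n)

    injected∉ : ∀ v → InvariantInjections (∁ (Lᵏ k)) w (λ m → ∃[ n ] N + n ≡ m) v → inject w v ∉ Lᵏ k
    injected∉ v inv = finitely-X∧often-top⇒∉ N (inject w v)
      (inject-all N w v early tail-NotX v-NotX) often
      where
      open InvariantInjections inv
      early : ∀ i → i < N → v i ≡ []
      early i i<N = only-at i λ { (n , refl) → <⇒≱ i<N (m≤m+n N n) }
      v-NotX : ∀ i → All NotX (v i)
      v-NotX i with N ≤? i
      ... | no N≰i  = subst (All NotX) (sym (early i (≰⇒> N≰i))) []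
      ... | yes N≤i = all-NotX (v i) λ l X∈ →
        X-not-invariant l (applyUpTo w (suc i)) (v i)
          (subst (λ i → state l (applyUpTo w (suc i)) ≡ s₁) (m+[n∸m]≡n N≤i)
            (trans (state-prefix l u (i ∸ N)) (all-s₁ l)))
          X∈ (invariant i)
      often : ∀ n → ∃[ m ] n ≤ m × inject w v m ≡ a top
      often n with m , le , e ← inject-⊇-word (N ⊔ n) w v =
        m , ≤-trans (m≤n⊔m N n) le , trans e (tail _ (m≤m⊔n N n))

  not-natural-0 : ∀ l u → state l u ≡ s₂ → ¬ NaturalColor (∁ (Lᵏ k)) 0 (u ++ω const (a top))
  not-natural-0 l u l-s₂ (at-home j mono home , _) = refute (home v inv)
    where
    N = length u
    w = u ++ω const (a top)

    -- A strictly increasing `j` dominates the identity. This makes membership in its range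
    -- decidable by a bounded search, and it shows that the range is unbounded.
    n≤j : ∀ n → n ≤ j n
    n≤j zero    = z≤n
    n≤j (suc n) = ≤-<-trans (n≤j n) (mono ≤-refl)

    J? : ∀ i → Dec (∃[ n ] j n ≡ i)
    J? i = map′ (λ { (n , e) → toℕ n , e })
      (λ { (n , refl) → fromℕ< (s≤s (n≤j n)) , cong j (toℕ-fromℕ< (s≤s (n≤j n))) })
      (any? λ (n : Fin (suc i)) → j (toℕ n) ≟ i)

    -- Points before `N` are left empty, since component `l` is known to be in `s₂` only once `u`
    -- has been read.
    site? : ∀ i → Dec (N ≤ i × ∃[ n ] j n ≡ i)
    site? i = (N ≤? i) ×-dec J? i

    v : ℕ → List (Letter k)
    v i with site? i
    ... | yes _ = X l ∷ []
    ... | no _  = []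

    inv : InvariantInjections (∁ (Lᵏ k)) w (λ m → ∃[ n ] j n ≡ m) v
    inv = record { only-at = only-at ; invariant = invariant }
      where
      only-at : ∀ i → ¬ (∃[ n ] j n ≡ i) → v i ≡ []
      only-at i i∉J with site? i
      ... | yes (_ , i∈J) = contradiction i∈J i∉J
      ... | no _          = refl
      invariant : ∀ i → residual (∁ (Lᵏ k)) (applyUpTo w (suc i))
                      ≐ residual (∁ (Lᵏ k)) (applyUpTo w (suc i) ++ v i)
      invariant i with site? i
      ... | no _ = (λ {w′} → subst (λ u → residual (∁ (Lᵏ k)) u w′) (sym (++-identityʳ p)))
                 , (λ {w′} → subst (λ u → residual (∁ (Lᵏ k)) u w′) (++-identityʳ p))
        where p = applyUpTo w (suc i)
      ... | yes (N≤i , _) =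
        (λ ∉L → ∉L ∘ Lᵏ-same-states (p ++ X l ∷ []) p (sym ∘ same)) ,
        (λ ∉L → ∉L ∘ Lᵏ-same-states p (p ++ X l ∷ []) same)
        where
        p = applyUpTo w (suc i)
        same : ∀ m → state m p ≡ state m (p ++ X l ∷ [])
        same = state-∷ʳ-X l p
          (subst (λ i → state l (applyUpTo w (suc i)) ≡ s₂) (m+[n∸m]≡n N≤i)
            (trans (state-prefix l u (i ∸ N)) l-s₂))

    X∈v : ∀ n → N ≤ n → X l ∈ˡ v (j n)
    X∈v n N≤n with site? (j n)
    ... | yes _ = here refl
    ... | no ∉  = contradiction (≤-trans N≤n (n≤j n) , n , refl) ∉

    injected∈ : inject w v ∈ Lᵏ k
    injected∈ = often-X⇒∈ (inject w v) λ n →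
      let m , le , e = inject-⊇-injected (j (N ⊔ n)) w v (X∈v (N ⊔ n) (m≤m⊔n N n)) in
      m , l , ≤-trans (m≤n⊔m N n) (≤-trans (n≤j (N ⊔ n)) le) , e

    refute : (∃[ i ] i < 0 × AtHome (∁ (Lᵏ k)) i (inject w v))
           ⊎ (w ∈ ∁ (Lᵏ k) × inject w v ∈ ∁ (Lᵏ k) × 2 ∣ 0)
           ⊎ (w ∉ ∁ (Lᵏ k) × inject w v ∉ ∁ (Lᵏ k) × 2 ∤ 0) → ⊥
    refute (inj₁ (_ , () , _))
    refute (inj₂ (inj₁ (_ , injected∉ , _))) = injected∉ injected∈
    refute (inj₂ (inj₂ (_ , _ , 2∤0)))       = 2∤0 (2 ∣0)

  -- Words separating the subsets of `Fin k`.

  members : (Fin k → Fin 2) → List (Fin k)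
  members s = filter (λ l → s l Fin.≟ suc zero) (allFin k)

  marks : (Fin k → Fin 2) → List (Letter k)
  marks s = map Y (members s)

  marks-∈ : ∀ s l → s l ≡ suc zero → state l (marks s) ≡ s₁
  marks-∈ s l l∈ = δ̂-Ys-∈ l (members s) (∈-filter⁺ _ (∈-allFin l) l∈)

  marks-∉ : ∀ s l → s l ≡ zero → state l (marks s) ≡ s₀
  marks-∉ s l l∉ = δ̂-Ys-∉ l (members s) λ l∈ →
    contradiction (trans (sym l∉) (proj₂ (∈-filter⁻ _ {xs = allFin k} l∈))) λ ()

  -- The order matters: `X l` is a loop at `s₀`, so reading it first leads component `l` to `s₂`
  -- only if `l` was marked. The `Y` letters then lift every component still in `s₀` to `s₁`.
  test : Fin k → List (Letter k)
  test l = X l ∷ map Y (allFin k)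

  state-marks-test : ∀ s l i → state i (marks s ++ test l) ≡ δ̂ i (state i (marks s)) (test l)
  state-marks-test s l i = foldl-++ (target (later-step k i)) s₀ (marks s) (test l)

  test-∉ : ∀ s l → s l ≡ zero → ∀ i → state i (marks s ++ test l) ≡ s₁
  test-∉ s l l∉ i = trans (state-marks-test s l i) (by-coordinate (l Fin.≟ i) (s i) refl)
    where
    Ys = map Y (allFin k)
    by-coordinate : Dec (l ≡ i) → ∀ b → s i ≡ b → δ̂ i (state i (marks s)) (test l) ≡ s₁
    by-coordinate (yes refl) _ _ rewrite marks-∉ s l l∉ = δ̂-Ys-∈ i (allFin k) (∈-allFin i)
    by-coordinate (no l≢i) zero i∉ rewrite marks-∉ s i i∉ = δ̂-Ys-∈ i (allFin k) (∈-allFin i)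
    by-coordinate (no l≢i) (suc zero) i∈ rewrite marks-∈ s i i∈ | later-X-≢ i s₁ l≢i =
      δ̂-Ys-s₁ i (allFin k)

  test-∈ : ∀ s l → s l ≡ suc zero → state l (marks s ++ test l) ≡ s₂
  test-∈ s l l∈ = trans (state-marks-test s l l)
    (trans (cong (λ q → δ̂ l q (test l)) (marks-∈ s l l∈)) (δ̂-X∈ l (test l) (here refl)))

  -- Counting the states of `B`.

  module _ (B : CoBuchi (Letter k)) (hd : HistoryDeterministic B)
           (color-zero : ∀ w → w ∉ Lang B ⇔ NaturalColor (∁ (Lᵏ k)) 0 w) where

    open Advice (proj₁ hd) using (advice)

    -- Both words are continued by `test l` and `top` forever. After `marks s` the result has
    -- natural color 0 and is rejected by `B`; equal advice would transfer this rejection to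
    -- `marks t`, where the color is not 0.
    separated : ∀ s t l → s l ≡ zero → t l ≡ suc zero → advice (marks s) ≢ advice (marks t)
    separated s t l l∉s l∈t same =
      not-natural-0 l (marks t ++ test l) (test-∈ t l l∈t)
        (Equivalence.to (color-zero _) (t∉ ∘ subst (_∈ Lang B) (++ω-assoc (marks t) (test l) _)))
      where
      s∉ : (marks s ++ω test l ++ω const (a top)) ∉ Lang B
      s∉ = Equivalence.from (color-zero _) (natural-0 (marks s ++ test l) (test-∉ s l l∉s))
         ∘ subst (_∈ Lang B) (sym (++ω-assoc (marks s) (test l) _))
      t∉ : (marks t ++ω test l ++ω const (a top)) ∉ Lang B
      t∉ = s∉ ∘ same-advice⇒same-residual B (proj₁ hd) (proj₂ hd) (marks t) (marks s) _ (sym same)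

    advice-injective : ∀ s t → advice (marks s) ≡ advice (marks t) → ∀ l → s l ≡ t l
    advice-injective s t same l with s l in s≡ | t l in t≡
    ... | zero     | zero     = refl
    ... | suc zero | suc zero = refl
    ... | zero     | suc zero = contradiction same (separated s t l s≡ t≡)
    ... | suc zero | zero     = contradiction (sym same) (separated t s l t≡ s≡)

    2^k≤size : 2 ^ k ≤ CoBuchi.size B
    2^k≤size = ≮⇒≥ λ size<2^k →
      -- `finToFun` enumerates the characteristic functions of the subsets. A collision yields two
      -- that agree pointwise, which `finToFun-injective` turns into equal indices.
      let i , j , i<j , same = pigeonhole size<2^k (λ i → advice (marks (finToFun i))) in
      <⇒≢ i<j (finToFun-injective (advice-injective (finToFun i) (finToFun j) same))

theorem6p2 : (k n : ℕ) (B : Fin (suc n) → CoBuchi (Letter k)) →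
    IsCOCOA (∁ (Lᵏ k)) B → 2 ^ k ≤ CoBuchi.size (B zero)
theorem6p2 k n B cocoa = 2^k≤size k (B zero) (history-deterministic zero) color-zero
  where open IsCOCOA cocoa
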